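{- Let $\mathbf{y}=(y_0,y_1,y_2)$ be a triple of positive integers with $y_0y_1y_2$ square-free, let $p>2$ be a prime with $p\mid y_0y_1y_2$, and let $r\geq 1$ be an integer. Then $$ \frac{N_{\mathbf{y}}^*(p^r)}{p^{2r}}= \left(1-\frac{1}{p}\right) \times \begin{cases} 1+\left(\frac{y_1y_2}{p}\right), & \text{if } p\mid y_0,\\ 1+\left(\frac{y_0y_2}{p}\right), & \text{if } p\mid y_1,\\ 1+\left(\frac{ -y_0y_1}{p}\right), & \text{if } p\mid y_2. \end{cases} $$
   Context: $\left(\frac{a}{p}\right)$ is the Legendre symbol. For a prime $p$ and $r\geq 1$, $N_{\mathbf{y}}^*(p^r)$ is the number of $\mathbf{x}=(x_0,x_1,x_2)\in(\mathbf{Z}/p^r\mathbf{Z})^3\setminus(p\mathbf{Z}/p^r\mathbf{Z})^3$ such that $y_0^3x_0^2+y_1^3x_1^2\equiv y_2^3x_2^2\pmod{p^r}$ and $\min_{0\leq i\leq 2}\{v_p(x_iy_i)\}=0$, i.e. $p\nmid x_iy_i$ for at least one $i\in\{0,1,2\}$. -}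

module Defs where

open import Data.Bool.Base using (if_then_else_)
open import Data.Fin.Base using (Fin; toℕ)
open import Data.Fin.Properties using (any?)
open import Data.Integer.Base as ℤ using (ℤ; +_; 0ℤ; 1ℤ; -1ℤ)
import Data.Integer.Divisibility as ℤ
open import Data.List.Base using (List; allFin; cartesianProduct; filter; length)
open import Data.Nat.Base using (ℕ; _+_; _*_; _^_)
open import Data.Nat.Divisibility using (_∣_; _∤_; _∣?_)
open import Data.Product.Base using (_×_; _,_; ∃)
open import Data.Sum.Base using (_⊎_)
open import Relation.Binary.PropositionalEquality using (_≡_)
open import Relation.Nullary.Decidable using (Dec; does; ¬?; _×-dec_; _⊎-dec_)
open import Relation.Nullary.Negation using (¬_)
open import Relation.Unary using (Decidable)

SquareFree : ℕ → Set
SquareFree n = ∀ d → d * d ∣ n → d ≡ 1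

infix 4 _≡_[mod_] _≡?_[mod_]

_≡_[mod_] : ℤ → ℤ → ℕ → Set
a ≡ b [mod n ] = + n ℤ.∣ a ℤ.- b

_≡?_[mod_] : ∀ a b n → Dec (a ≡ b [mod n ])
a ≡? b [mod n ] = n ∣? ℤ.∣ a ℤ.- b ∣

QuadraticResidue : ℕ → ℤ → Set
QuadraticResidue p a = ∃ λ (x : Fin p) → + (toℕ x ^ 2) ≡ a [mod p ]

quadraticResidue? : ∀ p → Decidable (QuadraticResidue p)
quadraticResidue? p a = any? λ x → + (toℕ x ^ 2) ≡? a [mod p ]

legendre : ℤ → ℕ → ℤ
legendre a p =
  if does (a ≡? 0ℤ [mod p ]) then 0ℤ
  else if does (quadraticResidue? p a) then 1ℤ
  else -1ℤ

Triple : Set → Set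
Triple A = A × A × A

-- ℤ/nℤ is represented by Fin n, through least non-negative residues.
residueTriples : ∀ n → List (Triple (Fin n))
residueTriples n = cartesianProduct (allFin n) (cartesianProduct (allFin n) (allFin n))

-- For r ≥ 1, divisibility by p does not depend on the representative modulo p ^ r.
IsCounted : Triple ℕ → (p r : ℕ) → Triple (Fin (p ^ r)) → Set
IsCounted (y₀ , y₁ , y₂) p r (x₀ , x₁ , x₂) =
    ¬ (p ∣ toℕ x₀ × p ∣ toℕ x₁ × p ∣ toℕ x₂)
  × + (y₀ ^ 3 * toℕ x₀ ^ 2 + y₁ ^ 3 * toℕ x₁ ^ 2) ≡ + (y₂ ^ 3 * toℕ x₂ ^ 2) [mod p ^ r ]
  × (p ∤ toℕ x₀ * y₀ ⊎ p ∤ toℕ x₁ * y₁ ⊎ p ∤ toℕ x₂ * y₂)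

isCounted? : ∀ y p r → Decidable (IsCounted y p r)
isCounted? (y₀ , y₁ , y₂) p r (x₀ , x₁ , x₂) =
        ¬? (p ∣? toℕ x₀ ×-dec p ∣? toℕ x₁ ×-dec p ∣? toℕ x₂)
  ×-dec + (y₀ ^ 3 * toℕ x₀ ^ 2 + y₁ ^ 3 * toℕ x₁ ^ 2) ≡? + (y₂ ^ 3 * toℕ x₂ ^ 2) [mod p ^ r ]
  ×-dec (¬? (p ∣? toℕ x₀ * y₀) ⊎-dec ¬? (p ∣? toℕ x₁ * y₁) ⊎-dec ¬? (p ∣? toℕ x₂ * y₂))

N* : Triple ℕ → (p r : ℕ) → ℕ
N* y p r = length (filter (isCounted? y p r) (residueTriples (p ^ r)))

{-# OPTIONS --safe #-}
module Submission where

-- Say p ∣ y₀; the other cases only permute the variables and signs. As y₀ y₁ y₂ is square-free, y₁ and y₂ are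
-- units modulo p, and the congruence shows that p ∤ x₁ iff p ∤ x₂, so that counted triples are the solutions with
-- p ∤ x₁. There are pʳ choices of x₀ and pʳ⁻¹ (p - 1) choices of x₁; for each of them, y₂³ x₂² ≡ unit has as many
-- solutions modulo pʳ as modulo p (Hensel), namely two or none according to whether y₁ y₂ is a square modulo p.

open import Defs
open import Data.Bool.Base using (true; false; if_then_else_)
open import Data.Fin.Base using (Fin; toℕ; fromℕ<)
open import Data.Fin.Properties using (toℕ-injective; toℕ<n; toℕ-fromℕ<)
open import Data.Integer.Base as ℤ using (ℤ; +_; -_; 1ℤ)
open import Data.Integer.DivMod using (n%ℕd<d; a≡a%ℕn+[a/ℕn]*n)
open import Data.Integer.Divisibility.Signed as ℤ
  using (divides; ∣ᵤ⇒∣; ∣⇒∣ᵤ; ∣-trans; ∣m∣n⇒∣m+n; ∣m∣n⇒∣m-n; ∣m⇒∣-m; ∣n⇒∣m*n; ∣m⇒∣m*n; *-cancelʳ-∣; *-monoˡ-∣)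
import Data.Integer.Properties as ℤ
open import Data.Integer.Tactic.RingSolver using (solve-∀)
open import Data.List.Base using (List; []; _∷_; _++_; allFin; cartesianProduct; filter; length; map)
open import Data.List.Membership.Propositional using (_∈_)
open import Data.List.Membership.Propositional.Properties
  using (∈-map⁺; ∈-map⁻; ∈-filter⁺; ∈-filter⁻; ∈-allFin; ∈-cartesianProduct⁺)
open import Data.List.Membership.Propositional.Properties.WithK using (unique∧set⇒bag)
open import Data.List.Properties using (length-++; length-map; length-tabulate; filter-++; filter-all; filter-none)
open import Data.List.Relation.Binary.BagAndSetEquality using (∼bag⇒↭)
open import Data.List.Relation.Binary.Permutation.Propositional.Properties using (↭-length)
open import Data.List.Relation.Unary.All as All using ([]; _∷_)
open import Data.List.Relation.Unary.AllPairs using ([]; _∷_)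
open import Data.List.Relation.Unary.Any using (here; there)
open import Data.List.Relation.Unary.Unique.Propositional using (Unique)
import Data.List.Relation.Unary.Unique.Propositional.Properties as Unique
open import Data.Nat.Base as ℕ using (ℕ; zero; suc; _^_; _≥_; _>_; NonZero)
open import Data.Nat.Coprimality using (Coprime; coprime-Bézout)
open import Data.Nat.Divisibility as ℕ using (_∣?_)
open import Data.Nat.GCD using (module Bézout)
open import Data.Nat.Primality using (Prime; prime⇒nonZero; prime⇒nonTrivial; prime⇒irreducible; euclidsLemma)
open import Data.Nat.Properties as ℕ using (m^n≢0)
import Data.Nat.Tactic.RingSolver as ℕ-Solver
open import Data.Product.Base using (_×_; _,_; proj₂; ∃)
open import Data.Rational.Base as ℚ using (1ℚ; _/_; toℚᵘ)
import Data.Rational.Properties as ℚ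
open import Data.Rational.Unnormalised.Base as ℚᵘ using (mkℚᵘ; 1ℚᵘ; *≡*; _≃_)
import Data.Rational.Unnormalised.Properties as ℚᵘ
open import Data.Sum.Base using (_⊎_; inj₁; inj₂; [_,_])
open import Data.Unit.Base using (⊤; tt)
open import Function.Base using (_∘_)
open import Function.Bundles using (mk⇔)
open import Level using (Level)
open import Relation.Binary.PropositionalEquality
  using (_≡_; _≢_; refl; sym; trans; cong; cong₂; subst; module ≡-Reasoning)
open import Relation.Nullary.Decidable using (Dec; yes; no; does; ¬?; decidable-stable)
open import Relation.Nullary.Negation using (¬_; contradiction)
open import Relation.Unary using (Decidable; Pred)

-- All three cases are brought to the shape `c³ x² ≡ e + b³ u²`, where `e` is the term of the
-- coordinate whose coefficient `p` divides. Modulo `p` this reads `(x / u)² ≡ (b / c)³`, and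
-- `(b / c)³` is `b c` times the square of `b / c²`. Solvability therefore depends on `b c` alone
-- and not on `u` or the free coordinate, so all fibres over a unit `u` have the same size, and the
-- count is a product. A minus sign is absorbed by a cube, which is why `p ∣ y₂` needs no separate
-- argument: it has `b = - y₀` and `c = y₁`. Newton's method supplies only the existence of a root
-- modulo `pʳ`; that there are exactly two comes from factoring the difference of two instances of
-- the equation. Exponents are written `suc s`, so that `p ^ r` unfolds to `p * p ^ s`.

private variable
  a b ℓ ℓ′ : Level
  A : Set a
  B : Set b

-- Counting in filtered lists and products

length-filter-map : {P : Pred B ℓ} (P? : Decidable P) (f : A → B) (xs : List A) →
                    length (filter P? (map f xs)) ≡ length (filter (P? ∘ f) xs)
length-filter-map P? f []       = refl
length-filter-map P? f (x ∷ xs) with does (P? (f x))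
... | true  = cong suc (length-filter-map P? f xs)
... | false = length-filter-map P? f xs

length-filter-¬ : {P : Pred A ℓ} (P? : Decidable P) (xs : List A) →
                  length (filter P? xs) ℕ.+ length (filter (¬? ∘ P?) xs) ≡ length xs
length-filter-¬ P? []       = refl
length-filter-¬ P? (x ∷ xs) with does (P? x)
... | true  = cong suc (length-filter-¬ P? xs)
... | false = trans (ℕ.+-suc _ _) (cong suc (length-filter-¬ P? xs))

-- Duplicate-free lists with the same members are permutations of each other, so a count follows
-- from any explicit enumeration `ys` of the solutions.
length-filter-unique : {P : Pred A ℓ} (P? : Decidable P) {xs ys : List A} →
                       Unique xs → Unique ys →
                       (∀ {x} → x ∈ xs → P x → x ∈ ys) →
                       (∀ {x} → x ∈ ys → x ∈ xs × P x) →
                       length (filter P? xs) ≡ length ys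
length-filter-unique P? {xs} xs! ys! to from = ↭-length (∼bag⇒↭ (unique∧set⇒bag
  (Unique.filter⁺ P? xs!) ys!
  (mk⇔ (λ x∈ → let x∈xs , Px = ∈-filter⁻ P? {xs = xs} x∈ in to x∈xs Px)
       (λ x∈ → let x∈xs , Px = from x∈ in ∈-filter⁺ P? x∈xs Px))))

-- Fibrewise counting: `Q` marks the first coordinates with a fibre of the common size `n`, and all
-- other fibres are empty.
length-filter-cartesianProduct :
  {P : Pred (A × B) ℓ} (P? : Decidable P) {Q : Pred A ℓ′} (Q? : Decidable Q)
  (xs : List A) (ys : List B) (n : ℕ) →
  (∀ x → Q x → length (filter (λ y → P? (x , y)) ys) ≡ n) →
  (∀ x → ¬ Q x → length (filter (λ y → P? (x , y)) ys) ≡ 0) →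
  length (filter P? (cartesianProduct xs ys)) ≡ length (filter Q? xs) ℕ.* n
length-filter-cartesianProduct P? Q? []       ys n fibre empty = refl
length-filter-cartesianProduct P? Q? (x ∷ xs) ys n fibre empty = trans split step
  where
  row = map (x ,_) ys
  rest = cartesianProduct xs ys
  split : length (filter P? (row ++ rest)) ≡
          length (filter (λ y → P? (x , y)) ys) ℕ.+ length (filter Q? xs) ℕ.* n
  split = trans (cong length (filter-++ P? row rest))
    (trans (length-++ (filter P? row))
      (cong₂ ℕ._+_ (length-filter-map P? (x ,_) ys)
        (length-filter-cartesianProduct P? Q? xs ys n fibre empty)))
  step : length (filter (λ y → P? (x , y)) ys) ℕ.+ length (filter Q? xs) ℕ.* n ≡
         length (filter Q? (x ∷ xs)) ℕ.* n
  step with Q? x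
  ... | yes Qx = cong (ℕ._+ _) (fibre x Qx)
  ... | no ¬Qx = cong (ℕ._+ _) (empty x ¬Qx)

module Arithmetic where
  open import Data.Integer.Base using (_+_; _-_; _*_; _/ℕ_; _%ℕ_)
  open import Data.Integer.Divisibility.Signed using (_∣_)

  -- Residues and congruences modulo `n`

  residue : ∀ n .{{_ : NonZero n}} → ℤ → Fin n
  residue n z = fromℕ< (n%ℕd<d z n)

  residue-≡ : ∀ n .{{_ : NonZero n}} z → + n ∣ z - + toℕ (residue n z)
  residue-≡ n z = divides (z /ℕ n) (begin
    z - + toℕ (residue n z)
      ≡⟨ cong (λ k → z - + k) (toℕ-fromℕ< (n%ℕd<d z n)) ⟩
    z - + (z %ℕ n)
      ≡⟨ cong (_- + (z %ℕ n)) (a≡a%ℕn+[a/ℕn]*n z n) ⟩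
    + (z %ℕ n) + (z /ℕ n) * + n - + (z %ℕ n)
      ≡⟨ cancel (+ (z %ℕ n)) ((z /ℕ n) * + n) ⟩
    (z /ℕ n) * + n ∎)
    where
    open ≡-Reasoning
    cancel : ∀ a b → a + b - a ≡ b
    cancel = solve-∀

  ∣-congˡ : ∀ {k l a} → k ≡ l → k ∣ a → l ∣ a
  ∣-congˡ refl k∣a = k∣a

  ∣-congʳ : ∀ {k a b} → k ∣ a → b ≡ a → k ∣ b
  ∣-congʳ k∣a refl = k∣a

  -- Both representatives lie below `n`, so their difference is smaller than `n` in absolute value,
  -- and `0` is the only multiple of `n` that small.
  toℕ-congruent⇒≡ : ∀ {n} (x y : Fin n) → + n ∣ + toℕ x - + toℕ y → x ≡ y
  toℕ-congruent⇒≡ {n} x y n∣ = toℕ-injective (ℤ.+-injective (ℤ.i-j≡0⇒i≡j _ _ (ℤ.∣i∣≡0⇒i≡0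
    (small ℤ.∣ + toℕ x - + toℕ y ∣ (∣⇒∣ᵤ n∣) bound))))
    where
    small : ∀ k → n ℕ.∣ k → k ℕ.< n → k ≡ 0
    small zero    _   _   = refl
    small (suc _) n∣k k<n = contradiction n∣k (ℕ.>⇒∤ k<n)
    bound : ℤ.∣ + toℕ x - + toℕ y ∣ ℕ.< n
    bound = ℕ.≤-<-trans (subst (λ i → ℤ.∣ i ∣ ℕ.≤ toℕ x ℕ.⊔ toℕ y) (sym (ℤ.m-n≡m⊖n (toℕ x) (toℕ y)))
      (ℤ.∣m⊝n∣≤m⊔n (toℕ x) (toℕ y))) (ℕ.⊔-pres-<m (toℕ<n x) (toℕ<n y))

  ≡-mod⇒≡-residue : ∀ n .{{_ : NonZero n}} (x : Fin n) z → + n ∣ + toℕ x - z → x ≡ residue n z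
  ≡-mod⇒≡-residue n x z n∣ = toℕ-congruent⇒≡ x (residue n z)
    (∣-congʳ (∣m∣n⇒∣m+n n∣ (residue-≡ n z)) (eq (+ toℕ x) z (+ toℕ (residue n z))))
    where
    eq : ∀ a b c → a - c ≡ (a - b) + (b - c)
    eq = solve-∀

  pos-^2 : ∀ n → + (n ^ 2) ≡ + n * + n
  pos-^2 n = trans (cong (λ m → + (n ℕ.* m)) (ℕ.*-identityʳ n)) (ℤ.pos-* n n)

  -- Units modulo a prime and its powers

  module _ (p : ℕ) (p-prime : Prime p) where

    ∣*⇒∣⊎∣ : ∀ a b → + p ∣ a * b → + p ∣ a ⊎ + p ∣ b
    ∣*⇒∣⊎∣ a b p∣ab with euclidsLemma ℤ.∣ a ∣ ℤ.∣ b ∣ p-prime (subst (p ℕ.∣_) (ℤ.abs-* a b) (∣⇒∣ᵤ p∣ab))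
    ... | inj₁ p∣a = inj₁ (∣ᵤ⇒∣ p∣a)
    ... | inj₂ p∣b = inj₂ (∣ᵤ⇒∣ p∣b)

    ∤* : ∀ a b → ¬ + p ∣ a → ¬ + p ∣ b → ¬ + p ∣ a * b
    ∤* a b p∤a p∤b = [ p∤a , p∤b ] ∘ ∣*⇒∣⊎∣ a b

    -- Bézout is applied to `p` and the absolute value of `a`; its two forms over ℕ, and then the
    -- sign of `a`, decide the sign of the inverse.
    invertible : ∀ a → ¬ + p ∣ a → ∃ λ b → + p ∣ a * b - 1ℤ
    invertible a p∤a = fromAbs (inverse∣a∣ (coprime-Bézout coprime))
      where
      coprime : Coprime p ℤ.∣ a ∣
      coprime (d∣p , d∣a) with prime⇒irreducible p-prime d∣p
      ... | inj₁ d≡1  = d≡1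
      ... | inj₂ refl = contradiction (∣ᵤ⇒∣ d∣a) p∤a

      inverse∣a∣ : Bézout.Identity 1 p ℤ.∣ a ∣ → ∃ λ b → + p ∣ + ℤ.∣ a ∣ * b - 1ℤ
      inverse∣a∣ (Bézout.+- x y eq) = - + y , divides (- + x)
        (trans (negate (+ ℤ.∣ a ∣) (+ y)) (trans (cong -_ bézout) (ℤ.neg-distribˡ-* (+ x) (+ p))))
        where
        negate : ∀ a y → a * (- y) - 1ℤ ≡ - (1ℤ + y * a)
        negate = solve-∀
        bézout : 1ℤ + + y * + ℤ.∣ a ∣ ≡ + x * + p
        bézout = trans (cong (λ k → 1ℤ + k) (sym (ℤ.pos-* y ℤ.∣ a ∣))) (trans (cong +_ eq) (ℤ.pos-* x p))
      inverse∣a∣ (Bézout.-+ x y eq) = + y , divides (+ x)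
        (trans (cong (_- 1ℤ) (trans (ℤ.*-comm (+ ℤ.∣ a ∣) (+ y)) (sym bézout))) (cancel (+ x * + p)))
        where
        cancel : ∀ k → 1ℤ + k - 1ℤ ≡ k
        cancel = solve-∀
        bézout : 1ℤ + + x * + p ≡ + y * + ℤ.∣ a ∣
        bézout = trans (cong (λ k → 1ℤ + k) (sym (ℤ.pos-* x p))) (trans (cong +_ eq) (ℤ.pos-* y ℤ.∣ a ∣))

      fromAbs : (∃ λ b → + p ∣ + ℤ.∣ a ∣ * b - 1ℤ) → ∃ λ b → + p ∣ a * b - 1ℤ
      fromAbs (b , p∣) with ℤ.+∣i∣≡i⊎+∣i∣≡-i a
      ... | inj₁ e = b , subst (λ k → + p ∣ k * b - 1ℤ) e p∣
      ... | inj₂ e = - b , ∣-congʳ p∣ (trans (move-neg a b) (cong (λ k → k * b - 1ℤ) (sym e)))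
        where
        move-neg : ∀ a b → a * (- b) - 1ℤ ≡ (- a) * b - 1ℤ
        move-neg = solve-∀

    pos-^-suc : ∀ n → + (p ^ suc n) ≡ + p * + (p ^ n)
    pos-^-suc n = ℤ.pos-* p (p ^ n)

    p∣p^suc : ∀ n → + p ∣ + (p ^ suc n)
    p∣p^suc n = ∣ᵤ⇒∣ (ℕ.m∣m*n (p ^ n))

    -- By induction `b` is `q pⁿ`; cancelling `pⁿ` from `pⁿ⁺¹ ∣ a q pⁿ` leaves `p ∣ a q`, so `p`
    -- divides `q` and one more power is gained.
    cancel-unit : ∀ n a b → ¬ + p ∣ a → + (p ^ n) ∣ a * b → + (p ^ n) ∣ b
    cancel-unit zero    a b p∤a _ = ∣ᵤ⇒∣ (ℕ.1∣ _)
    cancel-unit (suc n) a b p∤a pⁿ⁺¹∣ with cancel-unit n a b p∤a (∣-trans (∣ᵤ⇒∣ (ℕ.n∣m*n p)) pⁿ⁺¹∣)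
    ... | divides q refl with ∣*⇒∣⊎∣ a q (*-cancelʳ-∣ P
            (∣-congʳ (∣-congˡ (pos-^-suc n) pⁿ⁺¹∣) (ℤ.*-assoc a q P)))
      where
      P = + (p ^ n)
      instance _ = ℕ.m^n≢0 p n {{prime⇒nonZero p-prime}}
    ...   | inj₁ p∣a = contradiction p∣a p∤a
    ...   | inj₂ p∣q = ∣-congˡ (sym (pos-^-suc n)) (*-monoˡ-∣ (+ (p ^ n)) p∣q)

    -- Roots of `c x² ≡ d` modulo powers of `p`

    module _ (p∤2 : ¬ + p ∣ + 2) (c d : ℤ) (p∤c : ¬ + p ∣ c) (p∤d : ¬ + p ∣ d) where

      Root : ℕ → ℤ → Set
      Root n x = + n ∣ c * (x * x) - d

      Root-cong : ∀ {n} x y → + n ∣ x - y → Root n y → Root n x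
      Root-cong x y x≡y root =
        ∣-congʳ (∣m∣n⇒∣m+n root (∣n⇒∣m*n (c * (x + y)) x≡y)) (expand c x y d)
        where
        expand : ∀ c x y d → c * (x * x) - d ≡ (c * (y * y) - d) + c * (x + y) * (x - y)
        expand = solve-∀

      Root-neg : ∀ {n} x → Root n x → Root n (- x)
      Root-neg x root = ∣-congʳ root (expand c x d)
        where
        expand : ∀ c x d → c * (- x * - x) - d ≡ c * (x * x) - d
        expand = solve-∀

      Root-reduce : ∀ n x → Root (p ^ suc n) x → Root p x
      Root-reduce n x = ∣-trans (p∣p^suc n)

      root⇒unit : ∀ x → Root p x → ¬ + p ∣ x
      root⇒unit x root p∣x = p∤d (∣-congʳ (∣m∣n⇒∣m-n (∣n⇒∣m*n c (∣n⇒∣m*n x p∣x)) root) (isolate (c * (x * x)) d))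
        where
        isolate : ∀ a d → d ≡ a - (a - d)
        isolate = solve-∀

      -- Newton's step: if 2 c z v ≡ 1 (mod p) and c z² - d = q pⁿ⁺¹, then z - pⁿ⁺¹ q v is a root modulo pⁿ⁺².
      hensel-step : ∀ n → ∃ (Root (p ^ suc n)) → ∃ (Root (p ^ suc (suc n)))
      hensel-step n (z , root@(divides q eq))
        with v , divides k inv ← invertible (+ 2 * (c * z))
               (∤* _ _ p∤2 (∤* c z p∤c (root⇒unit z (Root-reduce n z root)))) =
        z - P * (q * v) ,
        -- The linear terms cancel up to a multiple of `p P`. The quadratic term `m P²` is one as
        -- well, since `P = p P′`; this works already for `n = 0`, where `P′ = 1`.
        ∣-congˡ (sym (pos-^-suc (suc n))) (divides (m * P′ - q * k) (begin
          c * ((z - P * (q * v)) * (z - P * (q * v))) - d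
            ≡⟨ expand c z P q v d ⟩
          (c * (z * z) - d) - P * q - P * q * (+ 2 * (c * z) * v - 1ℤ) + m * P * P
            ≡⟨ cong₂ (λ s t → s - P * q - P * q * t + m * P * P) eq inv ⟩
          q * P - P * q - P * q * (k * + p) + m * P * P
            ≡⟨ cong (λ s → q * P - P * q - P * q * (k * + p) + m * s * P) (pos-^-suc n) ⟩
          q * P - P * q - P * q * (k * + p) + m * (+ p * P′) * P
            ≡⟨ collect P P′ q k (+ p) m ⟩
          (m * P′ - q * k) * (+ p * P) ∎))
        where
        open ≡-Reasoning
        P = + (p ^ suc n)
        P′ = + (p ^ n)
        m = c * (q * q * (v * v))
        expand : ∀ c z P q v d →
          c * ((z - P * (q * v)) * (z - P * (q * v))) - d ≡
          (c * (z * z) - d) - P * q - P * q * (+ 2 * (c * z) * v - 1ℤ) + c * (q * q * (v * v)) * P * P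
        expand = solve-∀
        collect : ∀ P P′ q k p m →
          q * P - P * q - P * q * (k * p) + m * (p * P′) * P ≡ (m * P′ - q * k) * (p * P)
        collect = solve-∀

      hensel : ∀ n → ∃ (Root p) → ∃ (Root (p ^ suc n))
      hensel zero    (z , root) = z , ∣-congˡ (cong +_ (sym (ℕ.*-identityʳ p))) root
      hensel (suc n) root       = hensel-step n (hensel n root)

      z≢-z : ∀ z → Root p z → ¬ + p ∣ z - - z
      z≢-z z root p∣ = ∤* _ z p∤2 (root⇒unit z root) (∣-congʳ p∣ (double z))
        where
        double : ∀ z → + 2 * z ≡ z - - z
        double = solve-∀

      -- p divides at most one of x - z and x + z, as it does not divide 2 z.
      roots-± : ∀ n x z → Root (p ^ suc n) x → Root (p ^ suc n) z →
                + (p ^ suc n) ∣ x - z ⊎ + (p ^ suc n) ∣ x - - z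
      roots-± n x z root-x root-z with + p ℤ.∣? x - z
      ... | no p∤x-z  = inj₂ (cancel-unit (suc n) (x - z) _ p∤x-z product)
        where
        factor : ∀ c x z d → c * ((x - z) * (x - - z)) ≡ (c * (x * x) - d) - (c * (z * z) - d)
        factor = solve-∀
        product : + (p ^ suc n) ∣ (x - z) * (x - - z)
        product = cancel-unit (suc n) c _ p∤c (∣-congʳ (∣m∣n⇒∣m-n root-x root-z) (factor c x z d))
      ... | yes p∣x-z = inj₁ (cancel-unit (suc n) (x - - z) _ p∤x+z product)
        where
        factor : ∀ c x z d → c * ((x - - z) * (x - z)) ≡ (c * (x * x) - d) - (c * (z * z) - d)
        factor = solve-∀
        product : + (p ^ suc n) ∣ (x - - z) * (x - z)
        product = cancel-unit (suc n) c _ p∤c (∣-congʳ (∣m∣n⇒∣m-n root-x root-z) (factor c x z d))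
        difference : ∀ x z → z - - z ≡ (x - - z) - (x - z)
        difference = solve-∀
        p∤x+z : ¬ + p ∣ x - - z
        p∤x+z p∣x+z = z≢-z z (Root-reduce n z root-z) (∣-congʳ (∣m∣n⇒∣m-n p∣x+z p∣x-z) (difference x z))

      module _ (n : ℕ) {P : Pred (Fin (p ^ suc n)) ℓ} (P? : Decidable P)
               (P⇒Root : ∀ x → P x → Root (p ^ suc n) (+ toℕ x))
               (Root⇒P : ∀ x → Root (p ^ suc n) (+ toℕ x) → P x) where

        noRoots : ¬ ∃ (Root p) → length (filter P? (allFin (p ^ suc n))) ≡ 0
        noRoots ¬root = cong length (filter-none P?
          (All.universal (λ x Px → ¬root (+ toℕ x , Root-reduce n (+ toℕ x) (P⇒Root x Px))) (allFin _)))

        -- A lifted root `z` gives the enumeration `z`, `- z`: complete by `roots-±`, and without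
        -- repetition because `p` does not divide `2 z`. The predicate `P` is kept abstract, as the
        -- one eventually counted carries primitivity conditions besides the congruence.
        twoRoots : ∃ (Root p) → length (filter P? (allFin (p ^ suc n))) ≡ 2
        twoRoots root₁ with z , root-z ← hensel n root₁ =
          length-filter-unique P? (Unique.allFin⁺ N) ((z≢-z′ ∷ []) ∷ [] ∷ []) (λ {x} _ → to x) from
          where
          N = p ^ suc n
          instance
            p≢0 = prime⇒nonZero p-prime
            N≢0 = m^n≢0 p (suc n)

          z≢-z′ : residue N z ≢ residue N (- z)
          z≢-z′ eq = z≢-z z (Root-reduce n z root-z) (∣-trans (p∣p^suc n)
            (∣-congʳ (∣m∣n⇒∣m-n (residue-≡ N z) (subst (λ i → + N ∣ - z - + toℕ i) (sym eq) (residue-≡ N (- z))))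
                     (telescope z (+ toℕ (residue N z)))))
            where
            telescope : ∀ z r → z - - z ≡ (z - r) - (- z - r)
            telescope = solve-∀

          to : ∀ x → P x → x ∈ residue N z ∷ residue N (- z) ∷ []
          to x Px with roots-± n (+ toℕ x) z (P⇒Root x Px) root-z
          ... | inj₁ x≡z  = here (≡-mod⇒≡-residue N x z x≡z)
          ... | inj₂ x≡-z = there (here (≡-mod⇒≡-residue N x (- z) x≡-z))

          residue-root : ∀ y → Root N y → P (residue N y)
          residue-root y root = Root⇒P _ (Root-cong (+ toℕ (residue N y)) y
            (∣-congʳ (∣m⇒∣-m (residue-≡ N y)) (flip y (+ toℕ (residue N y)))) root)
            where
            flip : ∀ y r → r - y ≡ - (y - r)
            flip = solve-∀

          from : ∀ {x} → x ∈ residue N z ∷ residue N (- z) ∷ [] → x ∈ allFin N × P x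
          from (here refl)         = ∈-allFin _ , residue-root z root-z
          from (there (here refl)) = ∈-allFin _ , residue-root (- z) (Root-neg z root-z)

    -- Solvability modulo `p` and the size of a fibre

    -- If w² ≡ b c, then x = w b u c⁻² satisfies c³ x² ≡ b³ u².
    quadraticResidue⇒root : ∀ b c u {e} → + p ∣ e → ¬ + p ∣ c → QuadraticResidue p (b * c) →
                            ∃ λ x → + p ∣ c * c * c * (x * x) - (e + b * b * b * (u * u))
    quadraticResidue⇒root b c u {e} p∣e p∤c (w , w²≡bc) with v , cv≡1 ← invertible c p∤c =
      + toℕ w * b * u * (v * v) ,
      combine (+ p) (+ toℕ w) b c u v e
        (subst (λ i → + p ∣ i - b * c) (pos-^2 (toℕ w)) (∣ᵤ⇒∣ w²≡bc)) cv≡1 p∣e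
      where
      -- With `v = c⁻¹` the cubic term is `w² b² u² v (c v)³`. The quadratic cofactor comes from
      -- `(c v)³ - 1`; then `w²` becomes `b c`, and a last `c v` becomes `1`.
      expand : ∀ w b c u v e →
        c * c * c * (w * b * u * (v * v) * (w * b * u * (v * v))) - (e + b * b * b * (u * u)) ≡
        (w * w * (b * b) * (u * u) * v * (c * v * (c * v) + c * v + 1ℤ) + b * b * b * (u * u)) * (c * v - 1ℤ)
        + b * b * (u * u) * v * (w * w - b * c) - e
      expand = solve-∀
      combine : ∀ k w b c u v e → k ∣ w * w - b * c → k ∣ c * v - 1ℤ → k ∣ e →
        k ∣ c * c * c * (w * b * u * (v * v) * (w * b * u * (v * v))) - (e + b * b * b * (u * u))
      combine k w b c u v e w²≡bc cv≡1 k∣e = ∣-congʳ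
        (∣m∣n⇒∣m-n (∣m∣n⇒∣m+n
          (∣n⇒∣m*n (w * w * (b * b) * (u * u) * v * (c * v * (c * v) + c * v + 1ℤ) + b * b * b * (u * u)) cv≡1)
          (∣n⇒∣m*n (b * b * (u * u) * v) w²≡bc))
          k∣e)
        (expand w b c u v e)

    -- If c³ x² ≡ b³ u², then w = c² x (b u)⁻¹ satisfies w² ≡ b c.
    root⇒quadraticResidue : ∀ b c u {e} → + p ∣ e → ¬ + p ∣ b → ¬ + p ∣ u →
                            (∃ λ x → + p ∣ c * c * c * (x * x) - (e + b * b * b * (u * u))) →
                            QuadraticResidue p (b * c)
    root⇒quadraticResidue b c u {e} p∣e p∤b p∤u (x , root)
      with v , buv≡1 ← invertible (b * u) (∤* b u p∤b p∤u) =
      residue p (c * c * x * v) ,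
      ∣⇒∣ᵤ (subst (λ i → + p ∣ i - b * c) (sym (pos-^2 (toℕ (residue p (c * c * x * v)))))
        (combine (+ p) b c u v e x _ root p∣e buv≡1 (residue-≡ p (c * c * x * v))))
      where
      instance p≢0 = prime⇒nonZero p-prime
      -- Multiplying the equation by `c v²` gives `(c² x v)² ≡ b c (b u v)²`. The last term replaces
      -- `c² x v` by its representative `r`, since a quadratic residue is witnessed in `Fin p`.
      expand : ∀ b c u v e x r →
        r * r - b * c ≡
        c * (v * v) * (c * c * c * (x * x) - (e + b * b * b * (u * u))) + c * (v * v) * e
        + b * c * (b * u * v + 1ℤ) * (b * u * v - 1ℤ) - (c * c * x * v + r) * (c * c * x * v - r)
      expand = solve-∀
      combine : ∀ k b c u v e x r → k ∣ c * c * c * (x * x) - (e + b * b * b * (u * u)) → k ∣ e →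
        k ∣ b * u * v - 1ℤ → k ∣ c * c * x * v - r → k ∣ r * r - b * c
      combine k b c u v e x r root k∣e buv≡1 w≡r = ∣-congʳ
        (∣m∣n⇒∣m-n (∣m∣n⇒∣m+n (∣m∣n⇒∣m+n
          (∣n⇒∣m*n (c * (v * v)) root)
          (∣n⇒∣m*n (c * (v * v)) k∣e))
          (∣n⇒∣m*n (b * c * (b * u * v + 1ℤ)) buv≡1))
          (∣n⇒∣m*n (c * c * x * v + r) w≡r))
        (expand b c u v e x r)

    -- The number of square roots modulo an odd `p` of an `a` prime to `p`. For `p ∣ a` the value is
    -- 2 and no longer `1 + legendre a p`.
    #squareRoots : ℤ → ℕ
    #squareRoots a = if does (quadraticResidue? p a) then 2 else 0

    ≡-if : ∀ {A : Set} {x y z : ℕ} (A? : Dec A) → (A → x ≡ y) → (¬ A → x ≡ z) →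
           x ≡ (if does A? then y else z)
    ≡-if (yes a) x≡y x≡z = x≡y a
    ≡-if (no ¬a) x≡y x≡z = x≡z ¬a

    +#squareRoots≡1+legendre : ∀ a → ¬ + p ∣ a → + #squareRoots a ≡ 1ℤ + legendre a p
    +#squareRoots≡1+legendre a p∤a = cases (a ≡? ℤ.0ℤ [mod p ]) (does (quadraticResidue? p a))
      where
      cases : ∀ (0? : Dec (a ≡ ℤ.0ℤ [mod p ])) b →
              + (if b then 2 else 0) ≡ 1ℤ + (if does 0? then ℤ.0ℤ else if b then 1ℤ else ℤ.-1ℤ)
      cases (yes a≡0) _     = contradiction (∣-congʳ (∣ᵤ⇒∣ a≡0) (sym (ℤ.+-identityʳ a))) p∤a
      cases (no _)    true  = refl
      cases (no _)    false = refl

    ∤-cube : ∀ c → ¬ + p ∣ c → ¬ + p ∣ c * c * c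
    ∤-cube c p∤c = ∤* (c * c) c (∤* c c p∤c p∤c) p∤c

    ∤-norm : ∀ e b u → + p ∣ e → ¬ + p ∣ b → ¬ + p ∣ u → ¬ + p ∣ e + b * b * b * (u * u)
    ∤-norm e b u p∣e p∤b p∤u p∣d = ∤* (b * b * b) (u * u) (∤-cube b p∤b) (∤* u u p∤u p∤u)
      (ℤ.∣m+n∣m⇒∣n {m = e} {n = b * b * b * (u * u)} p∣d p∣e)

    module _ (p∤2 : ¬ + p ∣ + 2) (n : ℕ) (e b c u : ℤ) (p∣e : + p ∣ e) (p∤b : ¬ + p ∣ b) (p∤c : ¬ + p ∣ c)
             {P : Pred (Fin (p ^ suc n)) ℓ} (P? : Decidable P)
             (P⇒≡ : ∀ x → P x → + (p ^ suc n) ∣ c * c * c * (+ toℕ x * + toℕ x) - (e + b * b * b * (u * u)))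
             where

      -- The right-hand side is a unit because `p ∣ e`, so solvability modulo `p` decides between
      -- two and none. The answer is the same for all such `e` and `u`.
      length-unitFibre : ¬ + p ∣ u →
        (∀ x → + (p ^ suc n) ∣ c * c * c * (+ toℕ x * + toℕ x) - (e + b * b * b * (u * u)) → P x) →
        length (filter P? (allFin (p ^ suc n))) ≡ #squareRoots (b * c)
      length-unitFibre p∤u ≡⇒P = ≡-if (quadraticResidue? p (b * c))
        (λ qr → twoRoots p∤2 (c * c * c) (e + b * b * b * (u * u)) (∤-cube c p∤c) (∤-norm e b u p∣e p∤b p∤u)
                  n P? P⇒≡ ≡⇒P (quadraticResidue⇒root b c u p∣e p∤c qr))
        (λ ¬qr → noRoots p∤2 (c * c * c) (e + b * b * b * (u * u)) (∤-cube c p∤c) (∤-norm e b u p∣e p∤b p∤u)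
                  n P? P⇒≡ ≡⇒P (¬qr ∘ root⇒quadraticResidue b c u p∣e p∤b p∤u))

      -- If `p` divides `u` and `e`, then it divides `c³ x²` and hence `x`, contrary to primitivity,
      -- which enters as `P⇒unit`.
      length-nonunitFibre : + p ∣ u → (∀ x → P x → ¬ + p ∣ + toℕ x) →
                            length (filter P? (allFin (p ^ suc n))) ≡ 0
      length-nonunitFibre p∣u P⇒unit = cong length (filter-none P? (All.universal empty (allFin (p ^ suc n))))
        where
        isolate : ∀ a d → a ≡ (a - d) + d
        isolate = solve-∀
        p∣lhs : ∀ x → + p ∣ c * c * c * (x * x) - (e + b * b * b * (u * u)) → + p ∣ c * c * c * (x * x)
        p∣lhs x root = ∣-congʳ (∣m∣n⇒∣m+n root (∣m∣n⇒∣m+n p∣e (∣n⇒∣m*n (b * b * b) (∣m⇒∣m*n u p∣u))))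
          (isolate (c * c * c * (x * x)) (e + b * b * b * (u * u)))
        empty : ∀ x → ¬ P x
        empty x Px = ∤* (c * c * c) (X * X) (∤-cube c p∤c) (∤* X X (P⇒unit x Px) (P⇒unit x Px))
          (p∣lhs X (∣-trans (p∣p^suc n) (P⇒≡ x Px)))
          where X = + toℕ x

  -- The ternary form and its three rearrangements

  form : (y₀ y₁ y₂ x₀ x₁ x₂ : ℤ) → ℤ
  form y₀ y₁ y₂ x₀ x₁ x₂ = y₀ * y₀ * y₀ * (x₀ * x₀) + y₁ * y₁ * y₁ * (x₁ * x₁) - y₂ * y₂ * y₂ * (x₂ * x₂)

  pos-^3*^2 : ∀ y x → + (y ^ 3 ℕ.* x ^ 2) ≡ + y * + y * + y * (+ x * + x)
  pos-^3*^2 y x = trans (ℤ.pos-* (y ^ 3) (x ^ 2)) (cong₂ _*_ (trans (ℤ.pos-* y (y ^ 2))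
    (trans (cong (+ y *_) (pos-^2 y)) (sym (ℤ.*-assoc (+ y) (+ y) (+ y))))) (pos-^2 x))

  module _ (n y₀ y₁ y₂ x₀ x₁ x₂ : ℕ) where

    difference≡form : + (y₀ ^ 3 ℕ.* x₀ ^ 2 ℕ.+ y₁ ^ 3 ℕ.* x₁ ^ 2) - + (y₂ ^ 3 ℕ.* x₂ ^ 2) ≡
                      form (+ y₀) (+ y₁) (+ y₂) (+ x₀) (+ x₁) (+ x₂)
    difference≡form = cong₂ _-_
      (trans (ℤ.pos-+ (y₀ ^ 3 ℕ.* x₀ ^ 2) (y₁ ^ 3 ℕ.* x₁ ^ 2)) (cong₂ _+_ (pos-^3*^2 y₀ x₀) (pos-^3*^2 y₁ x₁)))
      (pos-^3*^2 y₂ x₂)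

    ≡[mod]⇒∣form : + (y₀ ^ 3 ℕ.* x₀ ^ 2 ℕ.+ y₁ ^ 3 ℕ.* x₁ ^ 2) ≡ + (y₂ ^ 3 ℕ.* x₂ ^ 2) [mod n ] →
                   + n ∣ form (+ y₀) (+ y₁) (+ y₂) (+ x₀) (+ x₁) (+ x₂)
    ≡[mod]⇒∣form sol = subst (+ n ∣_) difference≡form (∣ᵤ⇒∣ sol)

    ∣form⇒≡[mod] : + n ∣ form (+ y₀) (+ y₁) (+ y₂) (+ x₀) (+ x₁) (+ x₂) →
                   + (y₀ ^ 3 ℕ.* x₀ ^ 2 ℕ.+ y₁ ^ 3 ℕ.* x₁ ^ 2) ≡ + (y₂ ^ 3 ℕ.* x₂ ^ 2) [mod n ]
    ∣form⇒≡[mod] n∣ = ∣⇒∣ᵤ (subst (+ n ∣_) (sym difference≡form) n∣)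

  ∣-neg : ∀ {n a b} → + n ∣ a → - a ≡ b → + n ∣ b
  ∣-neg n∣a refl = ∣m⇒∣-m n∣a

  -- The index names the coordinate that will be free. The right-hand side has the shape
  -- `c³ x² - (e + b³ u²)`, with that coordinate in `e`.
  form-free₀ : ∀ y₀ y₁ y₂ x₀ x₁ x₂ →
    - form y₀ y₁ y₂ x₀ x₁ x₂ ≡ y₂ * y₂ * y₂ * (x₂ * x₂) - (y₀ * y₀ * y₀ * (x₀ * x₀) + y₁ * y₁ * y₁ * (x₁ * x₁))
  form-free₀ y₀ y₁ y₂ x₀ x₁ x₂ =
    negate (y₀ * y₀ * y₀ * (x₀ * x₀)) (y₁ * y₁ * y₁ * (x₁ * x₁)) (y₂ * y₂ * y₂ * (x₂ * x₂))
    where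
    negate : ∀ a b c → - (a + b - c) ≡ c - (a + b)
    negate = solve-∀

  form-free₁ : ∀ y₀ y₁ y₂ x₀ x₁ x₂ →
    - form y₀ y₁ y₂ x₀ x₁ x₂ ≡ y₂ * y₂ * y₂ * (x₂ * x₂) - (y₁ * y₁ * y₁ * (x₁ * x₁) + y₀ * y₀ * y₀ * (x₀ * x₀))
  form-free₁ y₀ y₁ y₂ x₀ x₁ x₂ =
    negate (y₀ * y₀ * y₀ * (x₀ * x₀)) (y₁ * y₁ * y₁ * (x₁ * x₁)) (y₂ * y₂ * y₂ * (x₂ * x₂))
    where
    negate : ∀ a b c → - (a + b - c) ≡ c - (b + a)
    negate = solve-∀

  -- Here `- y₀³` is written as `(- y₀)³`, so that `b = - y₀`; this is the source of the sign in the
  -- third Legendre symbol.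
  form-free₂ : ∀ y₀ y₁ y₂ x₀ x₁ x₂ →
    form y₀ y₁ y₂ x₀ x₁ x₂ ≡
    y₁ * y₁ * y₁ * (x₁ * x₁) - (y₂ * y₂ * y₂ * (x₂ * x₂) + - y₀ * - y₀ * - y₀ * (x₀ * x₀))
  form-free₂ = expand
    where
    expand : ∀ y₀ y₁ y₂ x₀ x₁ x₂ →
      y₀ * y₀ * y₀ * (x₀ * x₀) + y₁ * y₁ * y₁ * (x₁ * x₁) - y₂ * y₂ * y₂ * (x₂ * x₂) ≡
      y₁ * y₁ * y₁ * (x₁ * x₁) - (y₂ * y₂ * y₂ * (x₂ * x₂) + - y₀ * - y₀ * - y₀ * (x₀ * x₀))
    expand = solve-∀

open Arithmetic
open import Data.Nat.Base using (_+_; _*_)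
open import Data.Nat.Divisibility using (_∣_; _∤_)

-- From counts to rational densities

toℚᵘ-[1-1/suc] : ∀ k → toℚᵘ (1ℚ ℚ.- + 1 / suc k) ≃ mkℚᵘ (+ k) k
toℚᵘ-[1-1/suc] k = begin
  toℚᵘ (1ℚ ℚ.- + 1 / suc k)                 ≈⟨ ℚ.toℚᵘ-homo-+ 1ℚ (ℚ.- (+ 1 / suc k)) ⟩
  1ℚᵘ ℚᵘ.+ toℚᵘ (ℚ.- (+ 1 / suc k))         ≈⟨ ℚᵘ.+-congʳ 1ℚᵘ (ℚ.toℚᵘ-homo‿- (+ 1 / suc k)) ⟩
  1ℚᵘ ℚᵘ.- toℚᵘ (+ 1 / suc k)               ≈⟨ ℚᵘ.+-congʳ 1ℚᵘ (ℚᵘ.-‿cong (ℚ.toℚᵘ-fromℚᵘ (mkℚᵘ (+ 1) k))) ⟩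
  1ℚᵘ ℚᵘ.- mkℚᵘ (+ 1) k                     ≈⟨ *≡* (cong₂ (λ i j → + i ℤ.* + suc j) (ℕ.+-identityʳ k) (sym (ℕ.+-identityʳ k))) ⟩
  mkℚᵘ (+ k) k                              ∎
  where open ℚᵘ.≃-Reasoning

toℚᵘ-[1+l/1] : ∀ l → toℚᵘ (1ℚ ℚ.+ l / 1) ≃ mkℚᵘ (1ℤ ℤ.+ l) 0
toℚᵘ-[1+l/1] l = begin
  toℚᵘ (1ℚ ℚ.+ l / 1)        ≈⟨ ℚ.toℚᵘ-homo-+ 1ℚ (l / 1) ⟩
  1ℚᵘ ℚᵘ.+ toℚᵘ (l / 1)      ≈⟨ ℚᵘ.+-congʳ 1ℚᵘ (ℚ.toℚᵘ-fromℚᵘ (mkℚᵘ l 0)) ⟩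
  1ℚᵘ ℚᵘ.+ mkℚᵘ l 0          ≈⟨ *≡* (simplify l) ⟩
  mkℚᵘ (1ℤ ℤ.+ l) 0          ∎
  where
  open ℚᵘ.≃-Reasoning
  simplify : ∀ l → (1ℤ ℤ.+ l ℤ.* 1ℤ) ℤ.* 1ℤ ≡ (1ℤ ℤ.+ l) ℤ.* 1ℤ
  simplify = solve-∀

-- Normalised fractions are compared through ℚᵘ, where equality is cross-multiplication and `mkℚᵘ`
-- stores the denominator minus one; the claim then becomes the hypothesis on `m * p`.
/≡[1-1/p][1+l] : ∀ m n p .{{_ : NonZero n}} .{{_ : NonZero p}} ρ l → + ρ ≡ 1ℤ ℤ.+ l →
                 m * p ≡ ℕ.pred p * ρ * n → + m / n ≡ (1ℚ ℚ.- + 1 / p) ℚ.* (1ℚ ℚ.+ l / 1)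
/≡[1-1/p][1+l] m (suc n) (suc k) ρ l +ρ≡1+l eq = ℚ.toℚᵘ-injective (begin
  toℚᵘ (+ m / suc n)                                        ≈⟨ ℚ.toℚᵘ-fromℚᵘ (mkℚᵘ (+ m) n) ⟩
  mkℚᵘ (+ m) n                                              ≈⟨ *≡* cross ⟩
  mkℚᵘ (+ k) k ℚᵘ.* mkℚᵘ (+ ρ) 0                            ≡⟨ cong (λ i → mkℚᵘ (+ k) k ℚᵘ.* mkℚᵘ i 0) +ρ≡1+l ⟩
  mkℚᵘ (+ k) k ℚᵘ.* mkℚᵘ (1ℤ ℤ.+ l) 0                       ≈⟨ ℚᵘ.*-cong (toℚᵘ-[1-1/suc] k) (toℚᵘ-[1+l/1] l) ⟨
  toℚᵘ (1ℚ ℚ.- + 1 / suc k) ℚᵘ.* toℚᵘ (1ℚ ℚ.+ l / 1)        ≈⟨ ℚ.toℚᵘ-homo-* (1ℚ ℚ.- + 1 / suc k) (1ℚ ℚ.+ l / 1) ⟨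
  toℚᵘ ((1ℚ ℚ.- + 1 / suc k) ℚ.* (1ℚ ℚ.+ l / 1))            ∎)
  where
  open ℚᵘ.≃-Reasoning
  cross : + m ℤ.* + (suc k * 1) ≡ + k ℤ.* + ρ ℤ.* + suc n
  cross = trans (sym (ℤ.pos-* m (suc k * 1))) (trans
    (cong +_ (trans (cong (m *_) (ℕ.*-identityʳ (suc k))) eq))
    (trans (ℤ.pos-* (k * ρ) (suc n)) (cong (ℤ._* + suc n) (ℤ.pos-* k ρ))))

-- Multiples and non-multiples of `p` among residues

length-allFin : ∀ n → length (allFin n) ≡ n
length-allFin n = length-tabulate {n = n} (λ i → i)

nonmultiple? : ∀ p {n} (x : Fin n) → Dec (p ∤ toℕ x)
nonmultiple? p x = ¬? (p ∣? toℕ x)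

-- The multiples of `p` below `p * n` are enumerated by `p * i` with `i < n`.
length-multiples : ∀ p n .{{_ : NonZero p}} → length (filter (λ x → p ∣? toℕ x) (allFin (p * n))) ≡ n
length-multiples p n = trans
  (length-filter-unique (λ x → p ∣? toℕ x) (Unique.allFin⁺ (p * n)) (Unique.map⁺ multiple-injective (Unique.allFin⁺ n))
    (λ {x} _ p∣x → to x p∣x) from)
  (trans (length-map multiple (allFin n)) (length-allFin n))
  where
  multiple : Fin n → Fin (p * n)
  multiple i = fromℕ< (ℕ.*-monoʳ-< p (toℕ<n i))

  toℕ-multiple : ∀ i → toℕ (multiple i) ≡ p * toℕ i
  toℕ-multiple i = toℕ-fromℕ< (ℕ.*-monoʳ-< p (toℕ<n i))

  multiple-injective : ∀ {i j} → multiple i ≡ multiple j → i ≡ j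
  multiple-injective {i} {j} eq = toℕ-injective (ℕ.*-cancelˡ-≡ (toℕ i) (toℕ j) p
    (trans (sym (toℕ-multiple i)) (trans (cong toℕ eq) (toℕ-multiple j))))

  to : ∀ x → p ∣ toℕ x → x ∈ map multiple (allFin n)
  to x (ℕ.divides q x≡q*p) = subst (_∈ map multiple (allFin n)) (toℕ-injective multiple≡x)
    (∈-map⁺ multiple (∈-allFin (fromℕ< q<n)))
    where
    x≡p*q : toℕ x ≡ p * q
    x≡p*q = trans x≡q*p (ℕ.*-comm q p)
    q<n : q ℕ.< n
    q<n = ℕ.*-cancelˡ-< p q n (subst (ℕ._< p * n) x≡p*q (toℕ<n x))
    multiple≡x : toℕ (multiple (fromℕ< q<n)) ≡ toℕ x
    multiple≡x = trans (toℕ-multiple _) (trans (cong (p *_) (toℕ-fromℕ< q<n)) (sym x≡p*q))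

  from : ∀ {x} → x ∈ map multiple (allFin n) → x ∈ allFin (p * n) × p ∣ toℕ x
  from x∈ with i , _ , refl ← ∈-map⁻ multiple x∈ =
    ∈-allFin (multiple i) , subst (p ∣_) (sym (toℕ-multiple i)) (ℕ.m∣m*n (toℕ i))

length-nonmultiples : ∀ p n .{{_ : NonZero p}} →
                      length (filter (nonmultiple? p) (allFin (p * n))) ≡ ℕ.pred p * n
length-nonmultiples p@(suc k) n = ℕ.+-cancelˡ-≡ n _ _ (begin
  n + length (filter (nonmultiple? p) (allFin (p * n)))
    ≡⟨ cong (_+ length (filter (nonmultiple? p) (allFin (p * n)))) (length-multiples p n) ⟨
  length (filter (λ x → p ∣? toℕ x) (allFin (p * n))) + length (filter (nonmultiple? p) (allFin (p * n)))
    ≡⟨ length-filter-¬ (λ x → p ∣? toℕ x) (allFin (p * n)) ⟩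
  length (allFin (p * n))
    ≡⟨ length-allFin (p * n) ⟩
  n + k * n ∎)
  where open ≡-Reasoning

-- Permuting the coordinates of residue triples

residueTriples-unique : ∀ n → Unique (residueTriples n)
residueTriples-unique n = Unique.cartesianProduct⁺ (Unique.allFin⁺ n)
  (Unique.cartesianProduct⁺ (Unique.allFin⁺ n) (Unique.allFin⁺ n))

∈-residueTriples : ∀ n (x : Triple (Fin n)) → x ∈ residueTriples n
∈-residueTriples n (x₀ , x₁ , x₂) = ∈-cartesianProduct⁺ (∈-allFin x₀) (∈-cartesianProduct⁺ (∈-allFin x₁) (∈-allFin x₂))

-- A bijection of the triples preserves counts. It serves to move the coordinate whose coefficient
-- `p` divides to the front.
length-filter-residueTriples : ∀ {n} {P : Pred (Triple (Fin n)) ℓ} (P? : Decidable P) (f g : Triple (Fin n) → Triple (Fin n)) →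
  (∀ x → f (g x) ≡ x) → (∀ x → g (f x) ≡ x) →
  length (filter P? (residueTriples n)) ≡ length (filter (λ x → P? (f x)) (residueTriples n))
length-filter-residueTriples {n = n} {P} P? f g f∘g g∘f = trans
  (length-filter-unique P? (residueTriples-unique n)
    (Unique.map⁺ (λ {x} {y} eq → trans (sym (g∘f x)) (trans (cong g eq) (g∘f y)))
      (Unique.filter⁺ (λ x → P? (f x)) (residueTriples-unique n)))
    (λ {x} _ Px → subst (_∈ map f (filter (λ x → P? (f x)) (residueTriples n))) (f∘g x)
      (∈-map⁺ f (∈-filter⁺ (λ x → P? (f x)) (∈-residueTriples n (g x)) (subst P (sym (f∘g x)) Px))))
    from)
  (length-map f (filter (λ x → P? (f x)) (residueTriples n)))
  where
  from : ∀ {x} → x ∈ map f (filter (λ x → P? (f x)) (residueTriples n)) → x ∈ residueTriples n × P x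
  from x∈ with x , x∈filter , refl ← ∈-map⁻ f x∈ =
    ∈-residueTriples n (f x) , proj₂ (∈-filter⁻ (λ x → P? (f x)) {xs = residueTriples n} x∈filter)

-- Counting solutions in the three cases

module _ (p : ℕ) (p-prime : Prime p) (p>2 : p > 2) (s : ℕ) where

  N : ℕ
  N = p ^ suc s

  p∤2 : ¬ + p ℤ.∣ + 2
  p∤2 p∣2 = ℕ.>⇒∤ p>2 (∣⇒∣ᵤ p∣2)

  p∤* : ∀ {m n} → p ∤ m → p ∤ n → p ∤ m * n
  p∤* {m} {n} p∤m p∤n p∣mn = [ p∤m , p∤n ] (euclidsLemma m n p-prime p∣mn)

  p∣cube* : ∀ y z → p ∣ y → + p ℤ.∣ + y ℤ.* + y ℤ.* + y ℤ.* z
  p∣cube* y z p∣y = ∣m⇒∣m*n z (∣n⇒∣m*n (+ y ℤ.* + y) (∣ᵤ⇒∣ p∣y))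

  -- The variable f is free, u must be a unit, and then x ranges over the square roots of a unit.
  length-solutions : (e : Fin N → ℤ) (b c : ℤ) → (∀ f → + p ℤ.∣ e f) → ¬ + p ℤ.∣ b → ¬ + p ℤ.∣ c →
    {P : Pred (Triple (Fin N)) ℓ} (P? : Decidable P) →
    (∀ f u x → P (f , u , x) →
      + N ℤ.∣ c ℤ.* c ℤ.* c ℤ.* (+ toℕ x ℤ.* + toℕ x) ℤ.- (e f ℤ.+ b ℤ.* b ℤ.* b ℤ.* (+ toℕ u ℤ.* + toℕ u))) →
    (∀ f u x → p ∤ toℕ u →
      + N ℤ.∣ c ℤ.* c ℤ.* c ℤ.* (+ toℕ x ℤ.* + toℕ x) ℤ.- (e f ℤ.+ b ℤ.* b ℤ.* b ℤ.* (+ toℕ u ℤ.* + toℕ u)) →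
      P (f , u , x)) →
    (∀ f u x → p ∣ toℕ u → p ∣ toℕ x → ¬ P (f , u , x)) →
    length (filter P? (residueTriples N)) ≡ N * (ℕ.pred p * p ^ s * #squareRoots p p-prime (b ℤ.* c))
  length-solutions e b c p∣e p∤b p∤c {P} P? P⇒≡ ≡⇒P ¬P = begin
    length (filter P? (residueTriples N))
      -- The free coordinate is unrestricted, so the trivial `Q` is used and all `N` fibres have
      -- size `U * ρ`.
      ≡⟨ length-filter-cartesianProduct P? {Q = λ _ → ⊤} (λ _ → yes tt) (allFin N) pairs (U * ρ)
           (λ f _ → fibre₀ f) (λ f ¬⊤ → contradiction tt ¬⊤) ⟩
    length (filter {P = λ _ → ⊤} (λ _ → yes tt) (allFin N)) * (U * ρ)
      ≡⟨ cong (λ xs → length xs * (U * ρ)) (filter-all {P = λ _ → ⊤} (λ _ → yes tt) (All.universal (λ _ → tt) (allFin N))) ⟩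
    length (allFin N) * (U * ρ)
      ≡⟨ cong₂ (λ m k → m * (k * ρ)) (length-allFin N) (length-nonmultiples p (p ^ s)) ⟩
    N * (ℕ.pred p * p ^ s * ρ) ∎
    where
    open ≡-Reasoning
    instance p≢0 = prime⇒nonZero p-prime
    U = length (filter (nonmultiple? p) (allFin N))
    ρ = #squareRoots p p-prime (b ℤ.* c)
    pairs = cartesianProduct (allFin N) (allFin N)

    fibre₀ : ∀ f → length (filter (λ ux → P? (f , ux)) pairs) ≡ U * ρ
    fibre₀ f = length-filter-cartesianProduct (λ ux → P? (f , ux)) (nonmultiple? p) (allFin N) (allFin N) ρ
      (λ u p∤u → length-unitFibre p p-prime p∤2 s (e f) b c (+ toℕ u) (p∣e f) p∤b p∤c
        (λ x → P? (f , u , x)) (P⇒≡ f u) (λ p∣u → p∤u (∣⇒∣ᵤ p∣u)) (λ x → ≡⇒P f u x p∤u))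
      (λ u ¬p∤u → let p∣u = decidable-stable (p ∣? toℕ u) ¬p∤u in
        length-nonunitFibre p p-prime p∤2 s (e f) b c (+ toℕ u) (p∣e f) p∤b p∤c
        (λ x → P? (f , u , x)) (P⇒≡ f u) (∣ᵤ⇒∣ p∣u) (λ x Px p∣x → ¬P f u x p∣u (∣⇒∣ᵤ p∣x) Px))

  module _ (y₀ y₁ y₂ : ℕ) where

    y : Triple ℕ
    y = y₀ , y₁ , y₂

    N*-∣₀ : p ∣ y₀ → p ∤ y₁ → p ∤ y₂ →
            N* y p (suc s) ≡ N * (ℕ.pred p * p ^ s * #squareRoots p p-prime (+ y₁ ℤ.* + y₂))
    N*-∣₀ p∣y₀ p∤y₁ p∤y₂ = length-solutions _ (+ y₁) (+ y₂)
      (λ x₀ → p∣cube* y₀ (+ toℕ x₀ ℤ.* + toℕ x₀) p∣y₀) (p∤y₁ ∘ ∣⇒∣ᵤ) (p∤y₂ ∘ ∣⇒∣ᵤ) (isCounted? y p (suc s))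
      (λ x₀ x₁ x₂ (_ , sol , _) → ∣-neg (≡[mod]⇒∣form N y₀ y₁ y₂ (toℕ x₀) (toℕ x₁) (toℕ x₂) sol)
        (form-free₀ (+ y₀) (+ y₁) (+ y₂) (+ toℕ x₀) (+ toℕ x₁) (+ toℕ x₂)))
      (λ x₀ x₁ x₂ p∤x₁ N∣ →
        (λ (_ , p∣x₁ , _) → p∤x₁ p∣x₁) ,
        ∣form⇒≡[mod] N y₀ y₁ y₂ (toℕ x₀) (toℕ x₁) (toℕ x₂) (∣-neg N∣ (trans
          (cong -_ (sym (form-free₀ (+ y₀) (+ y₁) (+ y₂) (+ toℕ x₀) (+ toℕ x₁) (+ toℕ x₂))))
          (ℤ.neg-involutive (form (+ y₀) (+ y₁) (+ y₂) (+ toℕ x₀) (+ toℕ x₁) (+ toℕ x₂))))) ,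
        inj₂ (inj₁ (p∤* p∤x₁ p∤y₁)))
      -- The valuation condition fails here: `x₀ y₀` is divisible by `p` through `y₀`, the other two
      -- products through `x₁` and `x₂`.
      (λ x₀ x₁ x₂ p∣x₁ p∣x₂ (_ , _ , unit) →
        [ (λ p∤ → p∤ (ℕ.∣n⇒∣m*n (toℕ x₀) p∣y₀)) ,
        [ (λ p∤ → p∤ (ℕ.∣m⇒∣m*n y₁ p∣x₁)) , (λ p∤ → p∤ (ℕ.∣m⇒∣m*n y₂ p∣x₂)) ] ] unit)

    -- The involution `σ` exchanges the first two coordinates, so that `x₁` is free, `x₀` is the
    -- unit and `x₂` is the root.
    N*-∣₁ : p ∣ y₁ → p ∤ y₀ → p ∤ y₂ →
            N* y p (suc s) ≡ N * (ℕ.pred p * p ^ s * #squareRoots p p-prime (+ y₀ ℤ.* + y₂))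
    N*-∣₁ p∣y₁ p∤y₀ p∤y₂ = trans
      (length-filter-residueTriples (isCounted? y p (suc s)) σ σ (λ _ → refl) (λ _ → refl))
      (length-solutions _ (+ y₀) (+ y₂)
      (λ x₁ → p∣cube* y₁ (+ toℕ x₁ ℤ.* + toℕ x₁) p∣y₁) (p∤y₀ ∘ ∣⇒∣ᵤ) (p∤y₂ ∘ ∣⇒∣ᵤ) (λ x → isCounted? y p (suc s) (σ x))
      (λ x₁ x₀ x₂ (_ , sol , _) → ∣-neg (≡[mod]⇒∣form N y₀ y₁ y₂ (toℕ x₀) (toℕ x₁) (toℕ x₂) sol)
        (form-free₁ (+ y₀) (+ y₁) (+ y₂) (+ toℕ x₀) (+ toℕ x₁) (+ toℕ x₂)))
      (λ x₁ x₀ x₂ p∤x₀ N∣ →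
        (λ (p∣x₀ , _) → p∤x₀ p∣x₀) ,
        ∣form⇒≡[mod] N y₀ y₁ y₂ (toℕ x₀) (toℕ x₁) (toℕ x₂) (∣-neg N∣ (trans
          (cong -_ (sym (form-free₁ (+ y₀) (+ y₁) (+ y₂) (+ toℕ x₀) (+ toℕ x₁) (+ toℕ x₂))))
          (ℤ.neg-involutive (form (+ y₀) (+ y₁) (+ y₂) (+ toℕ x₀) (+ toℕ x₁) (+ toℕ x₂))))) ,
        inj₁ (p∤* p∤x₀ p∤y₀))
      (λ x₁ x₀ x₂ p∣x₀ p∣x₂ (_ , _ , unit) →
        [ (λ p∤ → p∤ (ℕ.∣m⇒∣m*n y₀ p∣x₀)) ,
        [ (λ p∤ → p∤ (ℕ.∣n⇒∣m*n (toℕ x₁) p∣y₁)) , (λ p∤ → p∤ (ℕ.∣m⇒∣m*n y₂ p∣x₂)) ] ] unit))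
      where
      σ : ∀ {A : Set} → Triple A → Triple A
      σ (x₁ , x₀ , x₂) = x₀ , x₁ , x₂

    -- y₀³ x₀² + y₁³ x₁² ≡ y₂³ x₂² is solved for x₁, as y₁³ x₁² ≡ y₂³ x₂² + (- y₀)³ x₀².
    N*-∣₂ : p ∣ y₂ → p ∤ y₀ → p ∤ y₁ →
            N* y p (suc s) ≡ N * (ℕ.pred p * p ^ s * #squareRoots p p-prime (- + y₀ ℤ.* + y₁))
    N*-∣₂ p∣y₂ p∤y₀ p∤y₁ = trans
      (length-filter-residueTriples (isCounted? y p (suc s)) σ τ (λ _ → refl) (λ _ → refl))
      (length-solutions _ (- + y₀) (+ y₁)
      (λ x₂ → p∣cube* y₂ (+ toℕ x₂ ℤ.* + toℕ x₂) p∣y₂)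
      (λ p∣-y₀ → p∤y₀ (subst (p ∣_) (ℤ.∣-i∣≡∣i∣ (+ y₀)) (∣⇒∣ᵤ p∣-y₀))) (p∤y₁ ∘ ∣⇒∣ᵤ)
      (λ x → isCounted? y p (suc s) (σ x))
      (λ x₂ x₀ x₁ (_ , sol , _) → subst (+ N ℤ.∣_)
        (form-free₂ (+ y₀) (+ y₁) (+ y₂) (+ toℕ x₀) (+ toℕ x₁) (+ toℕ x₂))
        (≡[mod]⇒∣form N y₀ y₁ y₂ (toℕ x₀) (toℕ x₁) (toℕ x₂) sol))
      (λ x₂ x₀ x₁ p∤x₀ N∣ →
        (λ (p∣x₀ , _) → p∤x₀ p∣x₀) ,
        ∣form⇒≡[mod] N y₀ y₁ y₂ (toℕ x₀) (toℕ x₁) (toℕ x₂)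
          (subst (+ N ℤ.∣_) (sym (form-free₂ (+ y₀) (+ y₁) (+ y₂) (+ toℕ x₀) (+ toℕ x₁) (+ toℕ x₂))) N∣) ,
        inj₁ (p∤* p∤x₀ p∤y₀))
      (λ x₂ x₀ x₁ p∣x₀ p∣x₁ (_ , _ , unit) →
        [ (λ p∤ → p∤ (ℕ.∣m⇒∣m*n y₀ p∣x₀)) ,
        [ (λ p∤ → p∤ (ℕ.∣m⇒∣m*n y₁ p∣x₁)) , (λ p∤ → p∤ (ℕ.∣n⇒∣m*n (toℕ x₂) p∣y₂)) ] ] unit))
      where
      σ τ : ∀ {A : Set} → Triple A → Triple A
      σ (x₂ , x₀ , x₁) = x₀ , x₁ , x₂
      τ (x₀ , x₁ , x₂) = x₂ , x₀ , x₁

    density-value : ∀ a → ¬ + p ℤ.∣ a →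
      N* y p (suc s) ≡ N * (ℕ.pred p * p ^ s * #squareRoots p p-prime a) →
      let instance
            p≢0 = prime⇒nonZero p-prime
            p²ʳ≢0 = m^n≢0 p (2 * suc s)
      in + N* y p (suc s) / p ^ (2 * suc s) ≡ (1ℚ ℚ.- + 1 / p) ℚ.* (1ℚ ℚ.+ legendre a p / 1)
    density-value a p∤a eq = /≡[1-1/p][1+l] (N* y p (suc s)) (p ^ (2 * suc s)) p ρ (legendre a p)
      (+#squareRoots≡1+legendre p p-prime a p∤a) (begin
        N* y p (suc s) * p                  ≡⟨ cong (_* p) eq ⟩
        N * (ℕ.pred p * p ^ s * ρ) * p      ≡⟨ regroup N (ℕ.pred p) (p ^ s) ρ p ⟩
        -- The spare factor `p` joins `p ^ s` to form a second `N`, as `p * p ^ s` is `N` by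
        -- definition; `2 * suc s` unfolds to `suc s + (suc s + 0)`.
        ℕ.pred p * ρ * (N * N)              ≡⟨ cong (λ m → ℕ.pred p * ρ * (N * m)) (cong (p ^_) (ℕ.+-identityʳ (suc s))) ⟨
        ℕ.pred p * ρ * (N * p ^ (suc s + 0))  ≡⟨ cong (ℕ.pred p * ρ *_) (ℕ.^-distribˡ-+-* p (suc s) (suc s + 0)) ⟨
        ℕ.pred p * ρ * p ^ (2 * suc s)      ∎)
      where
      open ≡-Reasoning
      instance
        p≢0 = prime⇒nonZero p-prime
        p²ʳ≢0 = m^n≢0 p (2 * suc s)
      ρ = #squareRoots p p-prime a
      regroup : ∀ N k q ρ p → N * (k * q * ρ) * p ≡ k * ρ * (N * (p * q))
      regroup = ℕ-Solver.solve-∀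

-- Otherwise `p * p` divides `a * b` and so `n`, which forces `p ≡ 1`.
squareFree⇒∤ : ∀ {n p} → SquareFree n → Prime p → ∀ {a b} → a * b ∣ n → p ∣ a → p ∤ b
squareFree⇒∤ sqfree p-prime ab∣n p∣a p∣b =
  ℕ.nonTrivial⇒≢1 {{prime⇒nonTrivial p-prime}} (sqfree _ (ℕ.∣-trans (ℕ.*-pres-∣ p∣a p∣b) ab∣n))

-- The case distinction is rendered as three implications; as `p` is prime and the product
-- square-free, exactly one premise holds.
lemma1 :
    (y₀ y₁ y₂ : ℕ) → y₀ > 0 → y₁ > 0 → y₂ > 0 →
    SquareFree (y₀ * y₁ * y₂) →
    (p : ℕ) (p-prime : Prime p) → p > 2 → p ∣ y₀ * y₁ * y₂ →
    (r : ℕ) → r ≥ 1 →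
    let instance
          p≢0 = prime⇒nonZero p-prime
          p²ʳ≢0 = m^n≢0 p (2 * r)
        density = + N* (y₀ , y₁ , y₂) p r / p ^ (2 * r)
        value = λ a → (1ℚ ℚ.- + 1 / p) ℚ.* (1ℚ ℚ.+ legendre a p / 1)
    in  (p ∣ y₀ → density ≡ value (+ (y₁ * y₂)))
      × (p ∣ y₁ → density ≡ value (+ (y₀ * y₂)))
      × (p ∣ y₂ → density ≡ value (- (+ (y₀ * y₁))))
lemma1 y₀ y₁ y₂ _ _ _ squareFree p p-prime p>2 _ (suc s) _ =
    (λ p∣y₀ → let p∤y₁ = excl₀₁ p∣y₀ ; p∤y₂ = excl₀₂ p∣y₀ in
      density-value p p-prime p>2 s y₀ y₁ y₂ _ (p∤product p∤y₁ p∤y₂)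
        (trans (N*-∣₀ p p-prime p>2 s y₀ y₁ y₂ p∣y₀ p∤y₁ p∤y₂) (count-cong (sym (ℤ.pos-* y₁ y₂)))))
  , (λ p∣y₁ → let p∤y₀ = (λ p∣y₀ → excl₀₁ p∣y₀ p∣y₁) ; p∤y₂ = excl₁₂ p∣y₁ in
      density-value p p-prime p>2 s y₀ y₁ y₂ _ (p∤product p∤y₀ p∤y₂)
        (trans (N*-∣₁ p p-prime p>2 s y₀ y₁ y₂ p∣y₁ p∤y₀ p∤y₂) (count-cong (sym (ℤ.pos-* y₀ y₂)))))
  , (λ p∣y₂ → let p∤y₀ = (λ p∣y₀ → excl₀₂ p∣y₀ p∣y₂) ; p∤y₁ = (λ p∣y₁ → excl₁₂ p∣y₁ p∣y₂) in
      density-value p p-prime p>2 s y₀ y₁ y₂ _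
        (λ p∣- → p∤product p∤y₀ p∤y₁ (∣-neg p∣- (ℤ.neg-involutive (+ (y₀ * y₁)))))
        (trans (N*-∣₂ p p-prime p>2 s y₀ y₁ y₂ p∣y₂ p∤y₀ p∤y₁)
          (count-cong (trans (sym (ℤ.neg-distribˡ-* (+ y₀) (+ y₁))) (cong -_ (sym (ℤ.pos-* y₀ y₁)))))))
  where
  excl₀₁ : p ∣ y₀ → p ∤ y₁
  excl₀₁ = squareFree⇒∤ squareFree p-prime (ℕ.m∣m*n y₂)
  excl₀₂ : p ∣ y₀ → p ∤ y₂
  excl₀₂ = squareFree⇒∤ squareFree p-prime (ℕ.divides y₁ (exchange y₀ y₁ y₂))
    where
    exchange : ∀ a b c → a * b * c ≡ b * (a * c)
    exchange = ℕ-Solver.solve-∀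
  excl₁₂ : p ∣ y₁ → p ∤ y₂
  excl₁₂ = squareFree⇒∤ squareFree p-prime (ℕ.divides y₀ (ℕ.*-assoc y₀ y₁ y₂))

  p∤product : ∀ {m n} → p ∤ m → p ∤ n → ¬ + p ℤ.∣ + (m * n)
  p∤product p∤m p∤n p∣mn = p∤* p p-prime p>2 s p∤m p∤n (∣⇒∣ᵤ p∣mn)

  count-cong : ∀ {a b} → a ≡ b →
    p ^ suc s * (ℕ.pred p * p ^ s * #squareRoots p p-prime a) ≡
    p ^ suc s * (ℕ.pred p * p ^ s * #squareRoots p p-prime b)
  count-cong = cong (λ a → p ^ suc s * (ℕ.pred p * p ^ s * #squareRoots p p-prime a))
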